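{- Let $P\in N_1$ be a sum of $4$ monomials, not necessarily distinct (i.e. $P(1)=4$). Then $P$ has unique factorisation inside $N_1$: any two factorisations of $P$ into irreducible elements of $N_1$ coincide up to the order of the factors.
   Context: $N_1=\mathbb{Z}_{\ge0}[X]$ is the semiring of univariate polynomials with nonnegative integer coefficients. An element $Q\neq0,1$ of $N_1$ is irreducible if in every factorisation $Q=ST$ with $S,T\in N_1$ one of $S,T$ is $1$. -}

module Defs where

open import Data.Nat using (ℕ; zero; suc; _+_; _*_)
open import Data.List using (List; []; _∷_; map; foldr)
open import Data.Product using (_×_)
open import Data.Sum using (_⊎_)
open import Level using (0ℓ)
open import Relation.Binary.Bundles using (Setoid)
open import Relation.Binary.PropositionalEquality using (_≡_; refl; sym; trans)
open import Relation.Nullary using (¬_)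

-- A list a₀ ∷ a₁ ∷ … ∷ [] stands for a₀ + a₁X + ….  Trailing zeros are
-- allowed, so equality of polynomials is _≈_, not _≡_.
N₁ : Set
N₁ = List ℕ

coeff : N₁ → ℕ → ℕ
coeff []      _       = 0
coeff (a ∷ _) zero    = a
coeff (_ ∷ p) (suc n) = coeff p n

infix 4 _≈_

-- A record rather than a bare function type, so that p and q can be
-- inferred from p ≈ q.
record _≈_ (p q : N₁) : Set where
  constructor mk≈
  field
    coeff≡ : ∀ n → coeff p n ≡ coeff q n

open _≈_ public

N₁-setoid : Setoid 0ℓ 0ℓ
N₁-setoid = record
  { Carrier       = N₁
  ; _≈_           = _≈_
  ; isEquivalence = record
    { refl  = mk≈ λ _ → refl
    ; sym   = λ e → mk≈ λ n → sym (coeff≡ e n)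
    ; trans = λ e f → mk≈ λ n → trans (coeff≡ e n) (coeff≡ f n)
    }
  }

0ₚ 1ₚ : N₁
0ₚ = []
1ₚ = 1 ∷ []

infixl 6 _+ₚ_
infixl 7 _*ₚ_

_+ₚ_ : N₁ → N₁ → N₁
[]      +ₚ q       = q
(a ∷ p) +ₚ []      = a ∷ p
(a ∷ p) +ₚ (b ∷ q) = (a + b) ∷ (p +ₚ q)

-- (a + X p) q = a q + X (p q)
_*ₚ_ : N₁ → N₁ → N₁
[]      *ₚ q = []
(a ∷ p) *ₚ q = map (a *_) q +ₚ (0 ∷ (p *ₚ q))

productₚ : List N₁ → N₁
productₚ = foldr _*ₚ_ 1ₚ

eval : N₁ → ℕ → ℕ
eval p x = foldr (λ a r → a + x * r) 0 p

Irreducible : N₁ → Set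
Irreducible Q =
  ¬ (Q ≈ 0ₚ) × ¬ (Q ≈ 1ₚ) ×
  (∀ S T → Q ≈ S *ₚ T → S ≈ 1ₚ ⊎ T ≈ 1ₚ)

{-# OPTIONS --safe #-}
-- Irreducibles divisible by X are X itself, and their number in a
-- factorisation of P is the order of P at 0.  The remaining irreducible
-- factors take values ≥ 2 at 1, so there is either one of them, or there are
-- two with value 2, namely 1 + X^a and 1 + X^b.  A single irreducible is not
-- such a product, and {a, b} is recovered from the exponents 0, a, b, a + b
-- of (1 + X^a)(1 + X^b) by repeatedly removing the least one.
module Submission where

open import Data.List using (List; []; _∷_; [_]; _++_; map; replicate)
open import Data.List.Relation.Unary.All using (All; []; _∷_)
open import Data.Nat
open import Data.Nat.Properties
open import Algebra.Properties.CommutativeSemigroup +-commutativeSemigroup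
  using (interchange; x∙yz≈y∙xz)
open import Data.Product as Product using (_×_; _,_; ∃)
open import Data.Sum using (_⊎_; inj₁; inj₂)
open import Relation.Binary.Bundles using (Setoid)
open import Relation.Binary.PropositionalEquality
  using (_≡_; _≢_; refl; sym; trans; cong; cong₂; subst; module ≡-Reasoning)
import Relation.Binary.Reasoning.Setoid as SetoidReasoning
open import Relation.Nullary using (¬_; yes; no; contradiction)
open import Defs
open import Data.List.Relation.Binary.Permutation.Setoid N₁-setoid
  using (_↭_; ↭-refl; ↭-sym; ↭-trans; ↭-prep; prep; swap)
open import Data.List.Relation.Binary.Permutation.Setoid.Properties N₁-setoid
  using (shift; ++⁺ˡ)

open Setoid N₁-setoid using ()
  renaming (refl to ≈-refl; sym to ≈-sym; trans to ≈-trans)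
module ≈-Reasoning = SetoidReasoning N₁-setoid

-- Coefficients

coeff-+ₚ : ∀ p q n → coeff (p +ₚ q) n ≡ coeff p n + coeff q n
coeff-+ₚ []      q       n       = refl
coeff-+ₚ (a ∷ p) []      n       = sym (+-identityʳ _)
coeff-+ₚ (a ∷ p) (b ∷ q) zero    = refl
coeff-+ₚ (a ∷ p) (b ∷ q) (suc n) = coeff-+ₚ p q n

coeff-map : ∀ a p n → coeff (map (a *_) p) n ≡ a * coeff p n
coeff-map a []      n       = sym (*-zeroʳ a)
coeff-map a (b ∷ p) zero    = refl
coeff-map a (b ∷ p) (suc n) = coeff-map a p n

coeff-∷-* : ∀ a p q n →
  coeff ((a ∷ p) *ₚ q) n ≡ a * coeff q n + coeff (0 ∷ (p *ₚ q)) n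
coeff-∷-* a p q n = trans (coeff-+ₚ (map (a *_) q) _ n)
  (cong (_+ coeff (0 ∷ (p *ₚ q)) n) (coeff-map a q n))

coeff-*-0 : ∀ p q → coeff (p *ₚ q) 0 ≡ coeff p 0 * coeff q 0
coeff-*-0 []      q = refl
coeff-*-0 (a ∷ p) q = trans (coeff-∷-* a p q 0) (+-identityʳ _)

∷-cong : ∀ {a b p q} → a ≡ b → p ≈ q → a ∷ p ≈ b ∷ q
∷-cong a≡b p≈q = mk≈ λ { zero → a≡b ; (suc n) → coeff≡ p≈q n }

tail-≈ : ∀ {a b p q} → a ∷ p ≈ b ∷ q → p ≈ q
tail-≈ e = mk≈ λ n → coeff≡ e (suc n)

tail-≈0 : ∀ {a p} → a ∷ p ≈ 0ₚ → p ≈ 0ₚ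
tail-≈0 e = mk≈ λ n → coeff≡ e (suc n)

0∷≈0 : ∀ {p} → p ≈ 0ₚ → 0 ∷ p ≈ 0ₚ
0∷≈0 e = mk≈ λ { zero → refl ; (suc n) → coeff≡ e n }

-- Multiplication

*-congˡ : ∀ p {q r} → q ≈ r → p *ₚ q ≈ p *ₚ r
*-congˡ []      e = ≈-refl
*-congˡ (a ∷ p) {q} {r} e = mk≈ λ n → begin
  coeff ((a ∷ p) *ₚ q) n                   ≡⟨ coeff-∷-* a p q n ⟩
  a * coeff q n + coeff (0 ∷ (p *ₚ q)) n   ≡⟨ cong₂ _+_ (cong (a *_) (coeff≡ e n))
                                               (coeff≡ (∷-cong refl (*-congˡ p e)) n) ⟩
  a * coeff r n + coeff (0 ∷ (p *ₚ r)) n   ≡⟨ coeff-∷-* a p r n ⟨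
  coeff ((a ∷ p) *ₚ r) n                   ∎
  where open ≡-Reasoning

≈0-* : ∀ {p} q → p ≈ 0ₚ → p *ₚ q ≈ 0ₚ
≈0-* {[]}    q e = ≈-refl
≈0-* {a ∷ p} q e = mk≈ λ n → trans (coeff-∷-* a p q n)
  (cong₂ _+_ (cong (_* coeff q n) (coeff≡ e 0))
             (coeff≡ (0∷≈0 (≈0-* q (tail-≈0 e))) n))

*-congʳ : ∀ {p q} r → p ≈ q → p *ₚ r ≈ q *ₚ r
*-congʳ {[]}    {q}     r e = ≈-sym (≈0-* r (≈-sym e))
*-congʳ {a ∷ p} {[]}    r e = ≈0-* r e
*-congʳ {a ∷ p} {b ∷ q} r e = mk≈ λ n → begin
  coeff ((a ∷ p) *ₚ r) n                   ≡⟨ coeff-∷-* a p r n ⟩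
  a * coeff r n + coeff (0 ∷ (p *ₚ r)) n   ≡⟨ cong₂ _+_ (cong (_* coeff r n) (coeff≡ e 0))
                                               (coeff≡ (∷-cong refl (*-congʳ r (tail-≈ e))) n) ⟩
  b * coeff r n + coeff (0 ∷ (q *ₚ r)) n   ≡⟨ coeff-∷-* b q r n ⟨
  coeff ((b ∷ q) *ₚ r) n                   ∎
  where open ≡-Reasoning

*-cong : ∀ {p q r s} → p ≈ q → r ≈ s → p *ₚ r ≈ q *ₚ s
*-cong {q = q} {r} e f = ≈-trans (*-congʳ r e) (*-congˡ q f)

*-identityʳₚ : ∀ p → p *ₚ 1ₚ ≈ p
*-identityʳₚ []      = ≈-refl
*-identityʳₚ (a ∷ p) = mk≈ λ
  { zero    → trans (+-identityʳ _) (*-identityʳ a)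
  ; (suc n) → coeff≡ (*-identityʳₚ p) n }

0∷-* : ∀ p q → (0 ∷ p) *ₚ q ≈ 0 ∷ (p *ₚ q)
0∷-* p q = mk≈ (coeff-∷-* 0 p q)

*-identityˡₚ : ∀ p → 1ₚ *ₚ p ≈ p
*-identityˡₚ p = mk≈ λ n → begin
  coeff (1ₚ *ₚ p) n                 ≡⟨ coeff-∷-* 1 [] p n ⟩
  1 * coeff p n + coeff (0 ∷ []) n  ≡⟨ cong₂ _+_ (*-identityˡ _) (coeff≡ (0∷≈0 ≈-refl) n) ⟩
  coeff p n + 0                     ≡⟨ +-identityʳ _ ⟩
  coeff p n                         ∎
  where open ≡-Reasoning

*-0∷ : ∀ p q → p *ₚ (0 ∷ q) ≈ 0 ∷ (p *ₚ q)
*-0∷ []      q = ≈-sym (0∷≈0 ≈-refl)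
*-0∷ (a ∷ p) q = mk≈ λ
  { zero    → trans (+-identityʳ _) (*-zeroʳ a)
  ; (suc n) → begin
      coeff ((a ∷ p) *ₚ (0 ∷ q)) (suc n)      ≡⟨ coeff-∷-* a p (0 ∷ q) (suc n) ⟩
      a * coeff q n + coeff (p *ₚ (0 ∷ q)) n  ≡⟨ cong (a * coeff q n +_) (coeff≡ (*-0∷ p q) n) ⟩
      a * coeff q n + coeff (0 ∷ (p *ₚ q)) n  ≡⟨ coeff-∷-* a p q n ⟨
      coeff ((a ∷ p) *ₚ q) n                  ∎ }
  where open ≡-Reasoning

-- Powers of X

infixr 8 X^_·_
infix  8 X^_ 1+X^_

X^_·_ : ℕ → N₁ → N₁
X^ m · p = replicate m 0 ++ p

X^_ : ℕ → N₁
X^ m = X^ m · 1ₚ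

X : N₁
X = X^ 1

X^-* : ∀ m p → (X^ m) *ₚ p ≈ X^ m · p
X^-* zero    p = *-identityˡₚ p
X^-* (suc m) p = ≈-trans (0∷-* (X^ m) p) (∷-cong refl (X^-* m p))

*-X^· : ∀ m p q → p *ₚ (X^ m · q) ≈ X^ m · (p *ₚ q)
*-X^· zero    p q = ≈-refl
*-X^· (suc m) p q = ≈-trans (*-0∷ p (X^ m · q)) (∷-cong refl (*-X^· m p q))

-- With nonzero constant terms, `m` and `n` are the orders at 0 of the two sides. Leading zeros are
-- stripped in parallel; if one side runs out first, a nonzero constant term faces a zero one.
X^·-injective : ∀ m n {p q} → coeff p 0 ≢ 0 → coeff q 0 ≢ 0 →
  X^ m · p ≈ X^ n · q → m ≡ n × p ≈ q
X^·-injective zero    zero    p₀ q₀ e = refl , e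
X^·-injective zero    (suc n) p₀ q₀ e = contradiction (coeff≡ e 0) p₀
X^·-injective (suc m) zero    p₀ q₀ e = contradiction (sym (coeff≡ e 0)) q₀
X^·-injective (suc m) (suc n) p₀ q₀ e with X^·-injective m n p₀ q₀ (tail-≈ e)
... | refl , p≈q = refl , p≈q

coeff-X^-self : ∀ k → coeff (X^ k) k ≡ 1
coeff-X^-self zero    = refl
coeff-X^-self (suc k) = coeff-X^-self k

coeff-X^-below : ∀ {k n} → n < k → coeff (X^ k) n ≡ 0
coeff-X^-below {suc k} {zero}  _         = refl
coeff-X^-below {suc k} {suc n} (s≤s n<k) = coeff-X^-below n<k

coeff-X^·-+ : ∀ m p q n →
  coeff (X^ m · (p +ₚ q)) n ≡ coeff (X^ m · p) n + coeff (X^ m · q) n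
coeff-X^·-+ zero    p q n       = coeff-+ₚ p q n
coeff-X^·-+ (suc m) p q zero    = refl
coeff-X^·-+ (suc m) p q (suc n) = coeff-X^·-+ m p q n

X^·X^ : ∀ m n → X^ m · X^ n ≡ X^ (m + n)
X^·X^ zero    n = refl
X^·X^ (suc m) n = cong (0 ∷_) (X^·X^ m n)

-- Binomials 1 + X^a

1+X^_ : ℕ → N₁
1+X^ a = 1ₚ +ₚ X^ a

-- Coefficients of (1 + X^a)(1 + X^b) - 1. The nesting puts X^a in front, ready to be removed first
-- when `a ≤ b`; a function into `ℕ` allows pointwise cancellation.
exponents : ℕ → ℕ → ℕ → ℕ
exponents a b n = coeff (X^ a) n + (coeff (X^ b) n + coeff (X^ (a + b)) n)

exponents-comm : ∀ a b n → exponents a b n ≡ exponents b a n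
exponents-comm a b n rewrite +-comm a b =
  x∙yz≈y∙xz (coeff (X^ a) n) (coeff (X^ b) n) _

-- The cases differ because `1+X^ 0` computes to `2 ∷ []`, where the two monomials merge, and
-- `1+X^ (suc a)` to `1 ∷ X^ a`.
1+X^-* : ∀ a q n → coeff ((1+X^ a) *ₚ q) n ≡ coeff q n + coeff (X^ a · q) n
1+X^-* zero q n = begin
  coeff ((2 ∷ []) *ₚ q) n              ≡⟨ coeff-∷-* 2 [] q n ⟩
  2 * coeff q n + coeff (0 ∷ []) n     ≡⟨ cong (2 * coeff q n +_) (coeff≡ (0∷≈0 ≈-refl) n) ⟩
  2 * coeff q n + 0                    ≡⟨ +-identityʳ _ ⟩
  coeff q n + (coeff q n + 0)          ≡⟨ cong (coeff q n +_) (+-identityʳ _) ⟩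
  coeff q n + coeff q n                ∎
  where open ≡-Reasoning
1+X^-* (suc a) q n = begin
  coeff ((1 ∷ X^ a) *ₚ q) n                  ≡⟨ coeff-∷-* 1 (X^ a) q n ⟩
  1 * coeff q n + coeff (0 ∷ ((X^ a) *ₚ q)) n  ≡⟨ cong₂ _+_ (*-identityˡ _)
                                                 (coeff≡ (∷-cong refl (X^-* a q)) n) ⟩
  coeff q n + coeff (0 ∷ X^ a · q) n         ∎
  where open ≡-Reasoning

1+X^-*-1+X^ : ∀ a b n →
  coeff ((1+X^ a) *ₚ (1+X^ b)) n ≡ coeff 1ₚ n + exponents a b n
1+X^-*-1+X^ a b n = begin
  coeff ((1+X^ a) *ₚ (1+X^ b)) n
    ≡⟨ 1+X^-* a (1+X^ b) n ⟩
  coeff (1+X^ b) n + coeff (X^ a · (1+X^ b)) n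
    ≡⟨ cong₂ _+_ (coeff-+ₚ 1ₚ (X^ b) n) (coeff-X^·-+ a 1ₚ (X^ b) n) ⟩
  (δ₀ + δ b) + (δ a + coeff (X^ a · X^ b) n)
    ≡⟨ cong (λ p → (δ₀ + δ b) + (δ a + coeff p n)) (X^·X^ a b) ⟩
  (δ₀ + δ b) + (δ a + δ (a + b))
    ≡⟨ +-assoc δ₀ (δ b) _ ⟩
  δ₀ + (δ b + (δ a + δ (a + b)))
    ≡⟨ cong (δ₀ +_) (x∙yz≈y∙xz (δ b) (δ a) _) ⟩
  δ₀ + exponents a b n ∎
  where
  open ≡-Reasoning
  δ₀ = coeff 1ₚ n
  δ : ℕ → ℕ
  δ k = coeff (X^ k) n

-- Recovering the exponents of a product of two binomials

VanishesBelow : ℕ → (ℕ → ℕ) → Set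
VanishesBelow a f = ∀ {n} → n < a → f n ≡ 0

-- If c < a, then at index `c` the left side is zero while the right side contains the coefficient 1
-- of X^c.
leadingExponent-≤ : ∀ {a c} {f g : ℕ → ℕ} → VanishesBelow a f →
  (∀ n → coeff (X^ a) n + f n ≡ coeff (X^ c) n + g n) → a ≤ c
leadingExponent-≤ {a} {c} {f} {g} f↓ H = ≮⇒≥ λ c<a → contradiction
  (begin
    suc (g c)             ≡⟨ cong (_+ g c) (coeff-X^-self c) ⟨
    coeff (X^ c) c + g c  ≡⟨ H c ⟨
    coeff (X^ a) c + f c  ≡⟨ cong₂ _+_ (coeff-X^-below c<a) (f↓ c<a) ⟩
    0                     ∎)
  λ ()
  where open ≡-Reasoning

-- The least exponents bound each other, so they agree and their common monomial can be subtracted.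
-- The remainders may still contain that exponent, which covers repeated exponents.
cancelLeast : ∀ {a c} {f g : ℕ → ℕ} → VanishesBelow a f → VanishesBelow c g →
  (∀ n → coeff (X^ a) n + f n ≡ coeff (X^ c) n + g n) →
  a ≡ c × (∀ n → f n ≡ g n)
cancelLeast {a} f↓ g↓ H
  with ≤-antisym (leadingExponent-≤ f↓ H) (leadingExponent-≤ g↓ (λ n → sym (H n)))
... | refl = refl , λ n → +-cancelˡ-≡ (coeff (X^ a) n) _ _ (H n)

X^+-vanishes : ∀ a b → VanishesBelow b (coeff (X^ (a + b)))
X^+-vanishes a b n<b = coeff-X^-below (<-≤-trans n<b (m≤n+m b a))

X^-tail-vanishes : ∀ {a b} → a ≤ b →
  VanishesBelow a (λ n → coeff (X^ b) n + coeff (X^ (a + b)) n)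
X^-tail-vanishes {a} {b} a≤b n<a = cong₂ _+_
  (coeff-X^-below (<-≤-trans n<a a≤b))
  (coeff-X^-below (<-≤-trans n<a (m≤m+n a b)))

-- Two removals suffice: first `a` against `c`, the least by sortedness, then `b` against `d`, since
-- b ≤ a + b and d ≤ c + d.
exponents-injective-sorted : ∀ {a b c d} → a ≤ b → c ≤ d →
  (∀ n → exponents a b n ≡ exponents c d n) → a ≡ c × b ≡ d
exponents-injective-sorted {a} {b} {c} {d} a≤b c≤d H
  with cancelLeast (X^-tail-vanishes a≤b) (X^-tail-vanishes c≤d) H
... | a≡c , H′ with cancelLeast (X^+-vanishes a b) (X^+-vanishes c d) H′
...   | b≡d , _ = a≡c , b≡d

exponents-injective : ∀ a b c d → (∀ n → exponents a b n ≡ exponents c d n) →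
  (a ≡ c × b ≡ d) ⊎ (a ≡ d × b ≡ c)
exponents-injective a b c d H with ≤-total a b | ≤-total c d
... | inj₁ a≤b | inj₁ c≤d = inj₁ (exponents-injective-sorted a≤b c≤d H)
... | inj₁ a≤b | inj₂ d≤c = inj₂ (exponents-injective-sorted a≤b d≤c
  λ n → trans (H n) (exponents-comm c d n))
... | inj₂ b≤a | inj₁ c≤d = inj₂ (Product.swap (exponents-injective-sorted b≤a c≤d
  λ n → trans (exponents-comm b a n) (H n)))
... | inj₂ b≤a | inj₂ d≤c = inj₁ (Product.swap (exponents-injective-sorted b≤a d≤c
  λ n → trans (exponents-comm b a n) (trans (H n) (exponents-comm c d n))))

1+X^-pair-injective : ∀ a b c d →
  (1+X^ a) *ₚ (1+X^ b) ≈ (1+X^ c) *ₚ (1+X^ d) →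
  (a ≡ c × b ≡ d) ⊎ (a ≡ d × b ≡ c)
1+X^-pair-injective a b c d e = exponents-injective a b c d λ n →
  +-cancelˡ-≡ (coeff 1ₚ n) _ _
    (trans (sym (1+X^-*-1+X^ a b n)) (trans (coeff≡ e n) (1+X^-*-1+X^ c d n)))

-- Values at 1

eval1-∷ : ∀ a p → eval (a ∷ p) 1 ≡ a + eval p 1
eval1-∷ a p = cong (a +_) (*-identityˡ _)

eval1-cong0 : ∀ {p} → p ≈ 0ₚ → eval p 1 ≡ 0
eval1-cong0 {[]}    e = refl
eval1-cong0 {a ∷ p} e =
  trans (eval1-∷ a p) (cong₂ _+_ (coeff≡ e 0) (eval1-cong0 (tail-≈0 e)))

eval1-cong : ∀ {p q} → p ≈ q → eval p 1 ≡ eval q 1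
eval1-cong {[]}    {q}     e = sym (eval1-cong0 (≈-sym e))
eval1-cong {a ∷ p} {[]}    e = eval1-cong0 e
eval1-cong {a ∷ p} {b ∷ q} e = cong₂ (λ x y → x + 1 * y) (coeff≡ e 0) (eval1-cong (tail-≈ e))

eval1-+ : ∀ p q → eval (p +ₚ q) 1 ≡ eval p 1 + eval q 1
eval1-+ []      q       = refl
eval1-+ (a ∷ p) []      = sym (+-identityʳ _)
eval1-+ (a ∷ p) (b ∷ q) = begin
  eval ((a + b) ∷ (p +ₚ q)) 1          ≡⟨ eval1-∷ (a + b) (p +ₚ q) ⟩
  (a + b) + eval (p +ₚ q) 1            ≡⟨ cong (a + b +_) (eval1-+ p q) ⟩
  (a + b) + (eval p 1 + eval q 1)      ≡⟨ interchange a b _ _ ⟩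
  (a + eval p 1) + (b + eval q 1)      ≡⟨ cong₂ _+_ (eval1-∷ a p) (eval1-∷ b q) ⟨
  eval (a ∷ p) 1 + eval (b ∷ q) 1      ∎
  where open ≡-Reasoning

eval1-map : ∀ a p → eval (map (a *_) p) 1 ≡ a * eval p 1
eval1-map a []      = sym (*-zeroʳ a)
eval1-map a (b ∷ p) = begin
  eval (a * b ∷ map (a *_) p) 1      ≡⟨ eval1-∷ (a * b) (map (a *_) p) ⟩
  a * b + eval (map (a *_) p) 1      ≡⟨ cong (a * b +_) (eval1-map a p) ⟩
  a * b + a * eval p 1               ≡⟨ *-distribˡ-+ a b _ ⟨
  a * (b + eval p 1)                 ≡⟨ cong (a *_) (eval1-∷ b p) ⟨
  a * eval (b ∷ p) 1                 ∎
  where open ≡-Reasoning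

eval1-* : ∀ p q → eval (p *ₚ q) 1 ≡ eval p 1 * eval q 1
eval1-* []      q = refl
eval1-* (a ∷ p) q = begin
  eval (map (a *_) q +ₚ (0 ∷ (p *ₚ q))) 1         ≡⟨ eval1-+ (map (a *_) q) _ ⟩
  eval (map (a *_) q) 1 + eval (0 ∷ (p *ₚ q)) 1   ≡⟨ cong₂ _+_ (eval1-map a q)
                                                      (trans (eval1-∷ 0 (p *ₚ q)) (eval1-* p q)) ⟩
  a * eval q 1 + eval p 1 * eval q 1              ≡⟨ *-distribʳ-+ (eval q 1) a _ ⟨
  (a + eval p 1) * eval q 1                       ≡⟨ cong (_* eval q 1) (eval1-∷ a p) ⟨
  eval (a ∷ p) 1 * eval q 1                       ∎
  where open ≡-Reasoning

eval1-X^· : ∀ m p → eval (X^ m · p) 1 ≡ eval p 1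
eval1-X^· zero    p = refl
eval1-X^· (suc m) p = trans (eval1-∷ 0 (X^ m · p)) (eval1-X^· m p)

-- The value at 1 is the sum of the coefficients, and natural numbers with sum 0 are all 0.
eval1≡0⇒≈0 : ∀ p → eval p 1 ≡ 0 → p ≈ 0ₚ
eval1≡0⇒≈0 []         e = ≈-refl
eval1≡0⇒≈0 (zero ∷ p) e = 0∷≈0 (eval1≡0⇒≈0 p (trans (sym (eval1-∷ 0 p)) e))

eval1≡1⇒X^ : ∀ p → eval p 1 ≡ 1 → ∃ λ k → p ≈ X^ k
eval1≡1⇒X^ (zero ∷ p) e with eval1≡1⇒X^ p (trans (sym (eval1-∷ 0 p)) e)
... | k , p≈X^k = suc k , ∷-cong refl p≈X^k
eval1≡1⇒X^ (suc zero ∷ p) e = 0 , ∷-cong refl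
  (eval1≡0⇒≈0 p (suc-injective (trans (sym (eval1-∷ 1 p)) e)))

eval1≡2⇒1+X^ : ∀ p → coeff p 0 ≢ 0 → eval p 1 ≡ 2 → ∃ λ a → p ≈ 1+X^ a
eval1≡2⇒1+X^ []             p₀ e = contradiction refl p₀
eval1≡2⇒1+X^ (zero ∷ p)     p₀ e = contradiction refl p₀
eval1≡2⇒1+X^ (suc zero ∷ p) p₀ e
  with eval1≡1⇒X^ p (suc-injective (trans (sym (eval1-∷ 1 p)) e))
... | k , p≈X^k = suc k , ∷-cong refl p≈X^k
-- The constant 2 is the degenerate binomial 1 + X^0.
eval1≡2⇒1+X^ (suc (suc zero) ∷ p) p₀ e = 0 , ∷-cong refl
  (eval1≡0⇒≈0 p (suc-injective (suc-injective (trans (sym (eval1-∷ 2 p)) e))))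

-- A nonzero constant term contributes at least 1; if it is exactly 1, the tail is nonzero because
-- `p` is not 1, and contributes another 1.
eval1≥2 : ∀ p → coeff p 0 ≢ 0 → ¬ p ≈ 1ₚ → 2 ≤ eval p 1
eval1≥2 []                p₀ p≉1 = contradiction refl p₀
eval1≥2 (zero ∷ p)        p₀ p≉1 = contradiction refl p₀
eval1≥2 (suc (suc a) ∷ p) p₀ p≉1 = s≤s (s≤s z≤n)
eval1≥2 (suc zero ∷ p)    p₀ p≉1 = subst (2 ≤_) (sym (eval1-∷ 1 p))
  (s≤s (n≢0⇒n>0 λ e → p≉1 (∷-cong refl (eval1≡0⇒≈0 p e))))

-- Irreducible factors

-- The irreducibles not divisible by X.
Proper : N₁ → Set
Proper Q = Irreducible Q × coeff Q 0 ≢ 0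

-- A zero constant term exhibits a factorisation with factor X, and since X is not 1, irreducibility
-- makes the cofactor 1.
irreducible-X∣ : ∀ Q → Irreducible Q → coeff Q 0 ≡ 0 → Q ≈ X
irreducible-X∣ []       (Q≉0 , _) _ = contradiction ≈-refl Q≉0
irreducible-X∣ (.0 ∷ Q) (_ , _ , split) refl
  with split X Q (≈-sym (X^-* 1 Q))
... | inj₁ X≈1 = contradiction (coeff≡ X≈1 0) λ ()
... | inj₂ Q≈1 = ∷-cong refl Q≈1

record SplitX (Qs : List N₁) : Set where
  field
    order    : ℕ
    rest     : List N₁
    proper   : All Proper rest
    perm     : Qs ↭ replicate order X ++ rest
    product≈ : productₚ Qs ≈ X^ order · productₚ rest

splitX : ∀ Qs → All Irreducible Qs → SplitX Qs
splitX [] [] = record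
  { order = 0 ; rest = [] ; proper = [] ; perm = ↭-refl ; product≈ = ≈-refl }
splitX (Q ∷ Qs) (Q-irr ∷ irr) with splitX Qs irr | coeff Q 0 ≟ 0
... | s | yes Q₀≡0 = record
  { order    = suc order
  ; rest     = rest
  ; proper   = proper
  ; perm     = prep Q≈X perm
  ; product≈ = ≈-trans (*-cong Q≈X product≈) (X^-* 1 _)
  }
  where
  open SplitX s
  Q≈X = irreducible-X∣ Q Q-irr Q₀≡0
... | s | no Q₀≢0 = record
  { order    = order
  ; rest     = Q ∷ rest
  ; proper   = (Q-irr , Q₀≢0) ∷ proper
  -- `shift` carries `Q` past the copies of X already collected.
  ; perm     = ↭-trans (↭-prep Q perm) (↭-sym (shift ≈-refl (replicate order X) rest))
  ; product≈ = ≈-trans (*-congˡ Q product≈) (*-X^· order Q _)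
  }
  where open SplitX s

-- The constant term is multiplicative and `ℕ` has no zero divisors.
product-proper-0 : ∀ {Qs} → All Proper Qs → coeff (productₚ Qs) 0 ≢ 0
product-proper-0 [] ()
product-proper-0 {Q ∷ Qs} ((_ , Q₀) ∷ ps) e
  with m*n≡0⇒m≡0∨n≡0 (coeff Q 0) (trans (sym (coeff-*-0 Q (productₚ Qs))) e)
... | inj₁ e′ = Q₀ e′
... | inj₂ e′ = product-proper-0 ps e′

proper-eval1 : ∀ {Q} → Proper Q → 2 ≤ eval Q 1
proper-eval1 {Q} ((_ , Q≉1 , _) , Q₀) = eval1≥2 Q Q₀ Q≉1

product-eval1≥1 : ∀ {Qs} → All Proper Qs → 1 ≤ eval (productₚ Qs) 1
product-eval1≥1 [] = ≤-refl
product-eval1≥1 {Q ∷ Qs} (p ∷ ps) rewrite eval1-* Q (productₚ Qs) =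
  *-mono-≤ (≤-trans (n≤1+n 1) (proper-eval1 p)) (product-eval1≥1 ps)

product-eval1≥2 : ∀ {Q Qs} → All Proper (Q ∷ Qs) → 2 ≤ eval (productₚ (Q ∷ Qs)) 1
product-eval1≥2 {Q} {Qs} (p ∷ ps) rewrite eval1-* Q (productₚ Qs) =
  *-mono-≤ (proper-eval1 p) (product-eval1≥1 ps)

-- Factorisations of value 4 without the factor X

m*n≡4⇒m≡n≡2 : ∀ {m n} → 2 ≤ m → 2 ≤ n → m * n ≡ 4 → m ≡ 2 × n ≡ 2
m*n≡4⇒m≡n≡2 {m} {n} 2≤m 2≤n e =
    ≤-antisym (*-cancelʳ-≤ m 2 2 (≤-trans (*-monoʳ-≤ m 2≤n) (≤-reflexive e))) 2≤m
  , ≤-antisym (*-cancelˡ-≤ 2 (≤-trans (*-monoˡ-≤ n 2≤m) (≤-reflexive e))) 2≤n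

-- A single factor of value 4 gets no explicit form: comparing factorisations uses only its
-- irreducibility. Explicit binomials are kept for pairs.
data Shape : List N₁ → Set where
  single : ∀ {Q} → Proper Q → Shape [ Q ]
  pair   : ∀ {Q R} a b → Proper Q → Proper R → Q ≈ 1+X^ a → R ≈ 1+X^ b →
           Shape (Q ∷ R ∷ [])

-- Every proper factor has value at least 2, so from two factors on, the head and the product of the
-- rest both have value exactly 2.
shape : ∀ {Qs} → All Proper Qs → eval (productₚ Qs) 1 ≡ 4 → Shape Qs
shape (p ∷ []) e = single p
shape {Q ∷ R ∷ Qs} (p ∷ p′ ∷ ps) e
  with m*n≡4⇒m≡n≡2 (proper-eval1 p) (product-eval1≥2 (p′ ∷ ps))
         (trans (sym (eval1-* Q (productₚ (R ∷ Qs)))) e)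
shape {Q ∷ R ∷ []} (p@(_ , Q₀) ∷ p′@(_ , R₀) ∷ []) e | Q≡2 , R≡2
  with eval1≡2⇒1+X^ Q Q₀ Q≡2
     | eval1≡2⇒1+X^ R R₀ (trans (sym (eval1-cong (*-identityʳₚ R))) R≡2)
... | a , Q≈ | b , R≈ = pair a b p p′ Q≈ R≈
-- With a third factor, the product after `Q` has value at least 2 * 2, yet it must be 2.
shape {Q ∷ R ∷ S ∷ Qs} (p ∷ p′ ∷ ps) e | _ , RS≡2 =
  contradiction (begin
    4                                        ≤⟨ *-mono-≤ (proper-eval1 p′) (product-eval1≥2 ps) ⟩
    eval R 1 * eval (productₚ (S ∷ Qs)) 1    ≡⟨ eval1-* R (productₚ (S ∷ Qs)) ⟨
    eval (productₚ (R ∷ S ∷ Qs)) 1           ≡⟨ RS≡2 ⟩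
    2                                        ∎) λ { (s≤s (s≤s ())) }
  where open ≤-Reasoning

-- Such an equality would factor `Q` as `R` times `S`, forcing one of these irreducibles to be 1.
irreducible-not-pair : ∀ {Q R S} → Irreducible Q → Irreducible R → Irreducible S →
  ¬ productₚ [ Q ] ≈ productₚ (R ∷ S ∷ [])
irreducible-not-pair {Q} {R} {S} (_ , _ , split) (_ , R≉1 , _) (_ , S≉1 , _) e
  with split R (S *ₚ 1ₚ) (≈-trans (≈-sym (*-identityʳₚ Q)) e)
... | inj₁ R≈1 = R≉1 R≈1
... | inj₂ S≈1 = S≉1 (≈-trans (≈-sym (*-identityʳₚ S)) S≈1)

-- Single factors agree once the trailing `1ₚ` is removed, mixed shapes contradict irreducibility,
-- and two pairs have the same exponents, in the same or the opposite order.
shape-unique : ∀ {Qs Rs} → Shape Qs → Shape Rs → productₚ Qs ≈ productₚ Rs → Qs ↭ Rs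
shape-unique {Q ∷ []} {R ∷ []} (single _) (single _) e =
  prep (≈-trans (≈-sym (*-identityʳₚ Q)) (≈-trans e (*-identityʳₚ R))) ↭-refl
shape-unique (single (q , _)) (pair _ _ (r , _) (s , _) _ _) e =
  contradiction e (irreducible-not-pair q r s)
shape-unique (pair _ _ (r , _) (s , _) _ _) (single (q , _)) e =
  contradiction (≈-sym e) (irreducible-not-pair q r s)
shape-unique (pair {Q} {Q′} a b _ _ Q≈ Q′≈) (pair {R} {R′} c d _ _ R≈ R′≈) e
  with 1+X^-pair-injective a b c d (let open ≈-Reasoning in begin
    (1+X^ a) *ₚ (1+X^ b)  ≈⟨ *-cong Q≈ (≈-trans (*-identityʳₚ Q′) Q′≈) ⟨
    Q *ₚ (Q′ *ₚ 1ₚ)       ≈⟨ e ⟩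
    R *ₚ (R′ *ₚ 1ₚ)       ≈⟨ *-cong R≈ (≈-trans (*-identityʳₚ R′) R′≈) ⟩
    (1+X^ c) *ₚ (1+X^ d)  ∎)
... | inj₁ (refl , refl) =
  prep (≈-trans Q≈ (≈-sym R≈)) (prep (≈-trans Q′≈ (≈-sym R′≈)) ↭-refl)
... | inj₂ (refl , refl) =
  swap (≈-trans Q≈ (≈-sym R′≈)) (≈-trans Q′≈ (≈-sym R≈)) ↭-refl

mainTheorem8 : (P : N₁) → eval P 1 ≡ 4 →
    (Qs Rs : List N₁) → All Irreducible Qs → All Irreducible Rs →
    P ≈ productₚ Qs → P ≈ productₚ Rs → Qs ↭ Rs
mainTheorem8 P P≡4 Qs Rs Qs-irr Rs-irr P≈Qs P≈Rs
  with splitX Qs Qs-irr | splitX Rs Rs-irr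
... | record { order = m ; rest = Qs′ ; proper = qs ; perm = Qs↭ ; product≈ = Qs≈ }
    | record { order = n ; rest = Rs′ ; proper = rs ; perm = Rs↭ ; product≈ = Rs≈ }
  -- Both remaining products have nonzero constant term, so the powers of X agree and cancel.
  with X^·-injective m n (product-proper-0 qs) (product-proper-0 rs)
         (≈-trans (≈-sym (≈-trans P≈Qs Qs≈)) (≈-trans P≈Rs Rs≈))
... | refl , Qs′≈Rs′ =
  ↭-trans Qs↭ (↭-trans (++⁺ˡ (replicate m X) Qs′↭Rs′) (↭-sym Rs↭))
  where
  Qs′≡4 : eval (productₚ Qs′) 1 ≡ 4
  -- X^m has value 1 at 1, so removing it preserves the value 4.
  Qs′≡4 = trans (sym (trans (eval1-cong (≈-trans P≈Qs Qs≈)) (eval1-X^· m _))) P≡4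
  Qs′↭Rs′ : Qs′ ↭ Rs′
  Qs′↭Rs′ = shape-unique (shape qs Qs′≡4)
    (shape rs (trans (sym (eval1-cong Qs′≈Rs′)) Qs′≡4)) Qs′≈Rs′
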